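{- Let $\omega = \sqrt{ -2}$ and $\mathcal{E}_{ -2} = \{ n \in \mathbb{Z}[\omega] : |n|^2 \le 3\}$. For every $n \in \mathbb{Z}[\omega] \setminus \mathcal{E}_{ -2}$ there exist nonzero $a,b,c \in \mathbb{Z}[\omega]$ with $\frac{4}{n} = \frac1a + \frac1b + \frac1c$.
   Context: $\mathbb{Z}[\sqrt{ -2}]$ is the ring of integers of $\mathbb{Q}(\sqrt{ -2})$; for $n = x + y\omega$ with $x,y\in\mathbb{Z}$, $|n|^2 = x^2 + 2y^2$. -}

module Defs where

open import Data.Integer using (ℤ; +_; _+_; _*_; _-_)
open import Relation.Binary.PropositionalEquality using (_≡_)
open import Relation.Nullary using (¬_)

-- Elements x + y·ω of ℤ[ω], ω = √-2, represented by their coordinates (x , y).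
record ℤω : Set where
  constructor _+_ω
  field
    re : ℤ
    im : ℤ
open ℤω public

-- ring operations of ℤ[√-2]  (ω² = -2)
_⊕_ : ℤω → ℤω → ℤω
(x + y ω) ⊕ (u + v ω) = (x + u) + (y + v) ω

_⊗_ : ℤω → ℤω → ℤω
(x + y ω) ⊗ (u + v ω) = (x * u - (+ 2) * (y * v)) + (x * v + y * u) ω

infixl 7 _⊗_
infixl 6 _⊕_

0ω : ℤω
0ω = (+ 0) + (+ 0) ω

4ω : ℤω
4ω = (+ 4) + (+ 0) ω

normω : ℤω → ℤ
normω (x + y ω) = x * x + (+ 2) * (y * y)

-- 4/n = 1/a + 1/b + 1/c in ℚ(√-2), for nonzero n, a, b, c, with denominators cleared:
-- 4·a·b·c = n·(b·c + a·c + a·b)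
EgyptianRep : ℤω → ℤω → ℤω → ℤω → Set
EgyptianRep n a b c = 4ω ⊗ a ⊗ b ⊗ c ≡ n ⊗ (b ⊗ c ⊕ a ⊗ c ⊕ a ⊗ b)

{-# OPTIONS --safe #-}
-- Choose a with n ≡ 4a - r for a small r, so that 4/n = 1/a + r/(na).  If r ∣ na, the remainder is a
-- unit fraction; if r ∣ 1 + e for some divisor e of na, then r/(na) = (1 + e)/(q na), where
-- rq = 1 + e, is a sum of two.  For n prime to √-2 one may take, up to sign, r = 1, r of norm 3 or
-- r = 1 ± 2√-2 (of norm 9), and one of e = ± a, ± n, ± na always works unless r ∣ na.  The other n are
-- multiples of such n, of 2, or of one of the four elements ± 2 ± √-2.
module Submission where

open import Defs
open import Algebra.Bundles using (CommutativeRing)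
open import Data.Fin using (Fin; zero; suc; toℕ; fromℕ<)
open import Data.Fin.Properties using (toℕ-fromℕ<)
open import Data.Integer using (ℤ; +_; -[1+_]; ∣_∣; _+_; _*_; _-_; -_; _>_; _≟_)
open import Data.Integer.DivMod using (_/ℕ_; a≡a%ℕn+[a/ℕn]*n; n%ℕd<d)
import Data.Integer.Properties as ℤ
open import Data.Integer.Tactic.RingSolver using () renaming (solve-∀ to ℤ-solve-∀)
open import Data.List using ([]; _∷_)
open import Data.Maybe using (just; nothing)
open import Data.Nat as ℕ using (ℕ; NonZero)
import Data.Nat.Properties as ℕ
open import Data.Product using (Σ; _×_; _,_)
open import Data.Sum using ([_,_]′; inj₁; inj₂)
open import Function using (_∘_)
open import Level using (0ℓ)
open import Relation.Binary.PropositionalEquality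
open import Relation.Nullary using (Dec; yes; no; contradiction)
open import Tactic.RingSolver using (solve; solve-∀)
open import Tactic.RingSolver.Core.AlmostCommutativeRing using (AlmostCommutativeRing; fromCommutativeRing)

open ≡-Reasoning

-- The commutative ring ℤ[√-2], set up for the ring solver.

ι : ℤ → ℤω
ι x = x + + 0 ω

1ω √-2 : ℤω
1ω = ι (+ 1)
√-2 = (+ 0) + (+ 1) ω

⊖_ : ℤω → ℤω
⊖ (x + y ω) = (- x) + (- y) ω

infix 8 ⊖_

⊕-assoc : ∀ a b c → a ⊕ b ⊕ c ≡ a ⊕ (b ⊕ c)
⊕-assoc (a + b ω) (c + d ω) (e + f ω) = cong₂ _+_ω (ℤ.+-assoc a c e) (ℤ.+-assoc b d f)

⊕-comm : ∀ a b → a ⊕ b ≡ b ⊕ a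
⊕-comm (a + b ω) (c + d ω) = cong₂ _+_ω (ℤ.+-comm a c) (ℤ.+-comm b d)

⊕-identityˡ : ∀ a → 0ω ⊕ a ≡ a
⊕-identityˡ (a + b ω) = cong₂ _+_ω (ℤ.+-identityˡ a) (ℤ.+-identityˡ b)

⊕-inverseˡ : ∀ a → ⊖ a ⊕ a ≡ 0ω
⊕-inverseˡ (a + b ω) = cong₂ _+_ω (ℤ.+-inverseˡ a) (ℤ.+-inverseˡ b)

⊗-assoc : ∀ a b c → a ⊗ b ⊗ c ≡ a ⊗ (b ⊗ c)
⊗-assoc (a + b ω) (c + d ω) (e + f ω) = cong₂ _+_ω (re-eq a b c d e f) (im-eq a b c d e f)
  where
  re-eq : ∀ a b c d e f →
    (a * c - + 2 * (b * d)) * e - + 2 * ((a * d + b * c) * f)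
    ≡ a * (c * e - + 2 * (d * f)) - + 2 * (b * (c * f + d * e))
  re-eq = ℤ-solve-∀
  im-eq : ∀ a b c d e f →
    (a * c - + 2 * (b * d)) * f + (a * d + b * c) * e
    ≡ a * (c * f + d * e) + b * (c * e - + 2 * (d * f))
  im-eq = ℤ-solve-∀

⊗-comm : ∀ a b → a ⊗ b ≡ b ⊗ a
⊗-comm (a + b ω) (c + d ω) = cong₂ _+_ω (re-eq a b c d) (im-eq a b c d)
  where
  re-eq : ∀ a b c d → a * c - + 2 * (b * d) ≡ c * a - + 2 * (d * b)
  re-eq = ℤ-solve-∀
  im-eq : ∀ a b c d → a * d + b * c ≡ c * b + d * a
  im-eq = ℤ-solve-∀

⊗-identityˡ : ∀ a → 1ω ⊗ a ≡ a
⊗-identityˡ (a + b ω) = cong₂ _+_ω (re-eq a b) (im-eq a b)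
  where
  re-eq : ∀ a b → + 1 * a - + 2 * (+ 0 * b) ≡ a
  re-eq = ℤ-solve-∀
  im-eq : ∀ a b → + 1 * b + + 0 * a ≡ b
  im-eq = ℤ-solve-∀

⊗-distribʳ-⊕ : ∀ a b c → (b ⊕ c) ⊗ a ≡ b ⊗ a ⊕ c ⊗ a
⊗-distribʳ-⊕ (a + b ω) (c + d ω) (e + f ω) = cong₂ _+_ω (re-eq a b c d e f) (im-eq a b c d e f)
  where
  re-eq : ∀ a b c d e f →
    (c + e) * a - + 2 * ((d + f) * b) ≡ (c * a - + 2 * (d * b)) + (e * a - + 2 * (f * b))
  re-eq = ℤ-solve-∀
  im-eq : ∀ a b c d e f →
    (c + e) * b + (d + f) * a ≡ (c * b + d * a) + (e * b + f * a)
  im-eq = ℤ-solve-∀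

ℤω-commutativeRing : CommutativeRing 0ℓ 0ℓ
ℤω-commutativeRing = record
  { Carrier = ℤω ; _≈_ = _≡_ ; _+_ = _⊕_ ; _*_ = _⊗_ ; -_ = ⊖_ ; 0# = 0ω ; 1# = 1ω
  ; isCommutativeRing = record
    { isRing = record
      { +-isAbelianGroup = record
        { isGroup = record
          { isMonoid = record
            { isSemigroup = record
              { isMagma = record { isEquivalence = isEquivalence ; ∙-cong = cong₂ _⊕_ }
              ; assoc = ⊕-assoc }
            ; identity = ⊕-identityˡ , λ a → trans (⊕-comm a 0ω) (⊕-identityˡ a) }
          ; inverse = ⊕-inverseˡ , λ a → trans (⊕-comm a (⊖ a)) (⊕-inverseˡ a)
          ; ⁻¹-cong = cong ⊖_ }
        ; comm = ⊕-comm }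
      ; *-cong = cong₂ _⊗_
      ; *-assoc = ⊗-assoc
      ; *-identity = ⊗-identityˡ , λ a → trans (⊗-comm a 1ω) (⊗-identityˡ a)
      ; distrib = (λ a b c → trans (⊗-comm a (b ⊕ c))
                    (trans (⊗-distribʳ-⊕ a b c) (cong₂ _⊕_ (⊗-comm b a) (⊗-comm c a))))
                  , ⊗-distribʳ-⊕ }
    ; *-comm = ⊗-comm }
  }

-- The test for zero lets the solver discard terms whose coefficients cancel.
ring : AlmostCommutativeRing 0ℓ 0ℓ
ring = fromCommutativeRing ℤω-commutativeRing
  λ { ((+ 0) + (+ 0) ω) → just refl ; _ → nothing }

-- The norm, its multiplicativity and the absence of zero divisors.

-- Natural-valued, so that order on ℕ applies and norms of closed elements compute.
‖_‖ : ℤω → ℕ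
‖ x + y ω ‖ = ∣ x ∣ ℕ.* ∣ x ∣ ℕ.+ 2 ℕ.* (∣ y ∣ ℕ.* ∣ y ∣)

square-abs : ∀ i → i * i ≡ + (∣ i ∣ ℕ.* ∣ i ∣)
square-abs (+ m) = sym (ℤ.pos-* m m)
square-abs -[1+ m ] = refl

normω-‖‖ : ∀ a → normω a ≡ + ‖ a ‖
normω-‖‖ (x + y ω) = cong₂ _+_ (square-abs x)
  (trans (cong (+ 2 *_) (square-abs y)) (sym (ℤ.pos-* 2 (∣ y ∣ ℕ.* ∣ y ∣))))

normω-⊗ : ∀ a b → normω (a ⊗ b) ≡ normω a * normω b
normω-⊗ (x + y ω) (u + v ω) = lemma x y u v
  where
  lemma : ∀ x y u v →
    (x * u - (+ 2) * (y * v)) * (x * u - (+ 2) * (y * v)) + (+ 2) * ((x * v + y * u) * (x * v + y * u))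
    ≡ (x * x + (+ 2) * (y * y)) * (u * u + (+ 2) * (v * v))
  lemma = ℤ-solve-∀

‖‖-⊗ : ∀ a b → ‖ a ⊗ b ‖ ≡ ‖ a ‖ ℕ.* ‖ b ‖
‖‖-⊗ a b = ℤ.+-injective (begin
  + ‖ a ⊗ b ‖         ≡⟨ normω-‖‖ (a ⊗ b) ⟨
  normω (a ⊗ b)       ≡⟨ normω-⊗ a b ⟩
  normω a * normω b   ≡⟨ cong₂ _*_ (normω-‖‖ a) (normω-‖‖ b) ⟩
  + ‖ a ‖ * + ‖ b ‖   ≡⟨ ℤ.pos-* ‖ a ‖ ‖ b ‖ ⟨
  + (‖ a ‖ ℕ.* ‖ b ‖) ∎)

square≡0⇒≡0 : ∀ i → ∣ i ∣ ℕ.* ∣ i ∣ ≡ 0 → i ≡ + 0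
square≡0⇒≡0 i eq with ℕ.m*n≡0⇒m≡0∨n≡0 ∣ i ∣ eq
... | inj₁ p = ℤ.∣i∣≡0⇒i≡0 p
... | inj₂ p = ℤ.∣i∣≡0⇒i≡0 p

‖‖≡0⇒≡0 : ∀ a → ‖ a ‖ ≡ 0 → a ≡ 0ω
‖‖≡0⇒≡0 (x + y ω) eq = cong₂ _+_ω
  (square≡0⇒≡0 x (ℕ.m+n≡0⇒m≡0 _ eq))
  (square≡0⇒≡0 y (ℕ.m+n≡0⇒m≡0 _ (ℕ.m+n≡0⇒n≡0 (∣ x ∣ ℕ.* ∣ x ∣) eq)))

-- The norm is multiplicative and vanishes only at zero.
⊗-nonzero : ∀ a b → a ≢ 0ω → b ≢ 0ω → a ⊗ b ≢ 0ω
⊗-nonzero a b a≢0 b≢0 ab≡0 =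
  [ a≢0 ∘ ‖‖≡0⇒≡0 a , b≢0 ∘ ‖‖≡0⇒≡0 b ]′ (ℕ.m*n≡0⇒m≡0∨n≡0 ‖ a ‖ ‖a‖*‖b‖≡0)
  where
  ‖a‖*‖b‖≡0 : ‖ a ‖ ℕ.* ‖ b ‖ ≡ 0
  ‖a‖*‖b‖≡0 = trans (sym (‖‖-⊗ a b)) (cong ‖_‖ ab≡0)

⊗-zeroʳ : ∀ a → a ⊗ 0ω ≡ 0ω
⊗-zeroʳ a = solve (a ∷ []) ring

⊗-zeroˡ : ∀ a → 0ω ⊗ a ≡ 0ω
⊗-zeroˡ a = solve (a ∷ []) ring

⊗-identityʳ : ∀ a → a ⊗ 1ω ≡ a
⊗-identityʳ a = solve (a ∷ []) ring

⊕≡0⇒≡⊖ : ∀ a b → a ⊕ b ≡ 0ω → a ≡ ⊖ b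
⊕≡0⇒≡⊖ a b eq = begin
  a             ≡⟨ solve (a ∷ b ∷ []) ring ⟩
  a ⊕ b ⊕ ⊖ b   ≡⟨ cong (_⊕ ⊖ b) eq ⟩
  0ω ⊕ ⊖ b      ≡⟨ ⊕-identityˡ (⊖ b) ⟩
  ⊖ b           ∎

-- Representability and its behaviour under multiples.

Big : ℤω → Set
Big n = 3 ℕ.< ‖ n ‖

Rep : ℤω → Set
Rep n = Σ ℤω λ a → Σ ℤω λ b → Σ ℤω λ c →
  a ≢ 0ω × b ≢ 0ω × c ≢ 0ω × EgyptianRep n a b c

big⇒nonzero : ∀ n → Big n → n ≢ 0ω
big⇒nonzero n () refl

-- Dividing 4/n = 1/a + 1/b + 1/c by m; with denominators cleared, both sides gain the factor m³.
rep-scale : ∀ n m → m ≢ 0ω → Rep n → Rep (m ⊗ n)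
rep-scale n m m≢0 (a , b , c , a≢0 , b≢0 , c≢0 , eq) =
  m ⊗ a , m ⊗ b , m ⊗ c ,
  ⊗-nonzero m a m≢0 a≢0 , ⊗-nonzero m b m≢0 b≢0 , ⊗-nonzero m c m≢0 c≢0 , (begin
  4ω ⊗ (m ⊗ a) ⊗ (m ⊗ b) ⊗ (m ⊗ c)
    ≡⟨ solve (m ∷ a ∷ b ∷ c ∷ []) ring ⟩
  m ⊗ m ⊗ m ⊗ (4ω ⊗ a ⊗ b ⊗ c)
    ≡⟨ cong (m ⊗ m ⊗ m ⊗_) eq ⟩
  m ⊗ m ⊗ m ⊗ (n ⊗ (b ⊗ c ⊕ a ⊗ c ⊕ a ⊗ b))
    ≡⟨ solve (m ∷ n ∷ a ∷ b ∷ c ∷ []) ring ⟩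
  m ⊗ n ⊗ ((m ⊗ b) ⊗ (m ⊗ c) ⊕ (m ⊗ a) ⊗ (m ⊗ c) ⊕ (m ⊗ a) ⊗ (m ⊗ b)) ∎)

-- Two ways to decompose the remainder r/(na).

2ω : ℤω
2ω = ι (+ 2)

-- 4/n = 1/a + r/(na), and r/(na) = 1/g = 1/(2g) + 1/(2g).
rep-of-divisor : ∀ n a r g → n ≢ 0ω → a ≢ 0ω →
  4ω ⊗ a ≡ n ⊕ r → n ⊗ a ≡ r ⊗ g → Rep n
rep-of-divisor n a r g n≢0 a≢0 4a≡n+r na≡rg =
  a , 2ω ⊗ g , 2ω ⊗ g , a≢0 , 2g≢0 , 2g≢0 , (begin
  4ω ⊗ a ⊗ (2ω ⊗ g) ⊗ (2ω ⊗ g)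
    ≡⟨ cong (λ s → s ⊗ (2ω ⊗ g) ⊗ (2ω ⊗ g)) 4a≡n+r ⟩
  (n ⊕ r) ⊗ (2ω ⊗ g) ⊗ (2ω ⊗ g)
    ≡⟨ solve (n ∷ r ∷ g ∷ []) ring ⟩
  4ω ⊗ g ⊗ (n ⊗ g ⊕ r ⊗ g)
    ≡⟨ cong (λ s → 4ω ⊗ g ⊗ (n ⊗ g ⊕ s)) na≡rg ⟨
  4ω ⊗ g ⊗ (n ⊗ g ⊕ n ⊗ a)
    ≡⟨ solve (n ∷ a ∷ g ∷ []) ring ⟩
  n ⊗ ((2ω ⊗ g) ⊗ (2ω ⊗ g) ⊕ a ⊗ (2ω ⊗ g) ⊕ a ⊗ (2ω ⊗ g)) ∎)
  where
  g≢0 : g ≢ 0ω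
  g≢0 refl = ⊗-nonzero n a n≢0 a≢0 (trans na≡rg (⊗-zeroʳ r))
  2g≢0 : 2ω ⊗ g ≢ 0ω
  2g≢0 = ⊗-nonzero 2ω g (λ ()) g≢0

-- 4/n = 1/a + r/(na), and r/(na) = (1 + e)/(q na) = 1/(q na) + 1/(q f).
rep-of-split : ∀ n a r e f q → n ≢ 0ω → a ≢ 0ω → 4ω ⊗ a ≡ n ⊕ r →
  e ⊗ f ≡ n ⊗ a → 1ω ⊕ e ≡ r ⊗ q → 1ω ⊕ e ≢ 0ω → Rep n
rep-of-split n a r e f q n≢0 a≢0 4a≡n+r ef≡na 1+e≡rq 1+e≢0 =
  a , q ⊗ (n ⊗ a) , q ⊗ f , a≢0 , ⊗-nonzero q (n ⊗ a) q≢0 na≢0 , ⊗-nonzero q f q≢0 f≢0 , (begin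
  4ω ⊗ a ⊗ (q ⊗ (n ⊗ a)) ⊗ (q ⊗ f)
    ≡⟨ cong (λ s → s ⊗ (q ⊗ (n ⊗ a)) ⊗ (q ⊗ f)) 4a≡n+r ⟩
  (n ⊕ r) ⊗ (q ⊗ (n ⊗ a)) ⊗ (q ⊗ f)
    ≡⟨ solve (n ∷ r ∷ q ∷ a ∷ f ∷ []) ring ⟩
  n ⊗ a ⊗ q ⊗ (n ⊗ q ⊗ f ⊕ r ⊗ q ⊗ f)
    ≡⟨ cong (λ s → n ⊗ a ⊗ q ⊗ (n ⊗ q ⊗ f ⊕ s ⊗ f)) 1+e≡rq ⟨
  n ⊗ a ⊗ q ⊗ (n ⊗ q ⊗ f ⊕ (1ω ⊕ e) ⊗ f)
    ≡⟨ solve (n ∷ a ∷ q ∷ e ∷ f ∷ []) ring ⟩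
  n ⊗ a ⊗ q ⊗ (n ⊗ q ⊗ f ⊕ f ⊕ e ⊗ f)
    ≡⟨ cong (λ s → n ⊗ a ⊗ q ⊗ (n ⊗ q ⊗ f ⊕ f ⊕ s)) ef≡na ⟩
  n ⊗ a ⊗ q ⊗ (n ⊗ q ⊗ f ⊕ f ⊕ n ⊗ a)
    ≡⟨ solve (n ∷ a ∷ q ∷ f ∷ []) ring ⟩
  n ⊗ ((q ⊗ (n ⊗ a)) ⊗ (q ⊗ f) ⊕ a ⊗ (q ⊗ f) ⊕ a ⊗ (q ⊗ (n ⊗ a))) ∎)
  where
  na≢0 : n ⊗ a ≢ 0ω
  na≢0 = ⊗-nonzero n a n≢0 a≢0
  q≢0 : q ≢ 0ω
  q≢0 refl = 1+e≢0 (trans 1+e≡rq (⊗-zeroʳ r))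
  f≢0 : f ≢ 0ω
  f≢0 refl = na≢0 (trans (sym ef≡na) (⊗-zeroʳ e))

-- Otherwise nb = -1, so n would be a unit and have norm 1.
big⇒1+n⊗b≢0 : ∀ n b → Big n → 1ω ⊕ n ⊗ b ≢ 0ω
big⇒1+n⊗b≢0 n b big eq = contradiction (subst (3 ℕ.<_) ‖n‖≡1 big) λ { (ℕ.s≤s ()) }
  where
  n⊗b≡-1 : n ⊗ b ≡ ⊖ 1ω
  n⊗b≡-1 = ⊕≡0⇒≡⊖ (n ⊗ b) 1ω (trans (⊕-comm (n ⊗ b) 1ω) eq)
  ‖n‖≡1 : ‖ n ‖ ≡ 1
  ‖n‖≡1 = ℕ.m*n≡1⇒m≡1 ‖ n ‖ ‖ b ‖ (trans (sym (‖‖-⊗ n b)) (cong ‖_‖ n⊗b≡-1))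

-- Integer representatives of residue classes.

-- The remainder lies in `Fin d`, so that residues can be enumerated by pattern matching.
divMod : ∀ d .{{_ : NonZero d}} x → Σ (Fin d) λ t → Σ ℤ λ j → x ≡ + toℕ t + j * + d
divMod d x = fromℕ< (n%ℕd<d x d) , x /ℕ d ,
  trans (a≡a%ℕn+[a/ℕn]*n x d)
    (cong (λ t → + t + (x /ℕ d) * + d) (sym (toℕ-fromℕ< (n%ℕd<d x d))))

ι-homo : ∀ t j d → ι (t + j * d) ≡ ι t ⊕ ι j ⊗ ι d
ι-homo t j d = cong₂ _+_ω (re-eq t j d) (im-eq j d)
  where
  re-eq : ∀ t j d → t + j * d ≡ t + (j * d - + 0)
  re-eq = ℤ-solve-∀
  im-eq : ∀ j d → + 0 ≡ + 0 + (j * + 0 + + 0 * d)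
  im-eq = ℤ-solve-∀

-- Since √-2 ≡ β modulo r, the element x + y√-2 is congruent to the integer x + yβ.
residue : ∀ r r̄ α β d .{{_ : NonZero d}} → r ⊗ r̄ ≡ ι (+ d) → √-2 ≡ r ⊗ α ⊕ ι β →
  ∀ a → Σ (Fin d) λ t → Σ ℤω λ g → a ≡ r ⊗ g ⊕ ι (+ toℕ t)
residue r r̄ α β d rr̄≡d √-2≡rα+β (x + y ω) with divMod d (x + y * β)
-- The quotient collects α y, from √-2 = rα + β, and r̄ j, from j d = r r̄ j.
... | t , j , eq = t , α ⊗ ι y ⊕ r̄ ⊗ ι j , (begin
  x + y ω
    ≡⟨ cong₂ _+_ω (re-eq x y β) (im-eq y β) ⟩
  ι (x + y * β) ⊕ ι y ⊗ (√-2 ⊕ ⊖ ι β)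
    ≡⟨ cong₂ (λ s w → s ⊕ ι y ⊗ (w ⊕ ⊖ ι β)) (trans (cong ι eq) (ι-homo (+ toℕ t) j (+ d))) √-2≡rα+β ⟩
  ι (+ toℕ t) ⊕ ι j ⊗ ι (+ d) ⊕ ι y ⊗ (r ⊗ α ⊕ ι β ⊕ ⊖ ι β)
    ≡⟨ cong (λ s → ι (+ toℕ t) ⊕ ι j ⊗ s ⊕ ι y ⊗ (r ⊗ α ⊕ ι β ⊕ ⊖ ι β)) rr̄≡d ⟨
  ι (+ toℕ t) ⊕ ι j ⊗ (r ⊗ r̄) ⊕ ι y ⊗ (r ⊗ α ⊕ ι β ⊕ ⊖ ι β)
    ≡⟨ rearrange (ι (+ toℕ t)) (ι j) (ι y) (ι β) r r̄ α ⟩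
  r ⊗ (α ⊗ ι y ⊕ r̄ ⊗ ι j) ⊕ ι (+ toℕ t) ∎)
  where
  re-eq : ∀ x y β → x ≡ x + y * β + (y * (+ 0 + - β) - + 0)
  re-eq = ℤ-solve-∀
  im-eq : ∀ y β → y ≡ + 0 + (y * + 1 + + 0 * (+ 0 + - β))
  im-eq = ℤ-solve-∀
  rearrange : ∀ t j y β r r̄ α →
    t ⊕ j ⊗ (r ⊗ r̄) ⊕ y ⊗ (r ⊗ α ⊕ β ⊕ ⊖ β) ≡ r ⊗ (α ⊗ y ⊕ r̄ ⊗ j) ⊕ t
  rearrange = solve-∀ ring

-- Representations from the class of `a` modulo `r`.

4a≡n+r⇒n≡4a-r : ∀ n a r → 4ω ⊗ a ≡ n ⊕ r → n ≡ 4ω ⊗ a ⊕ ⊖ r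
4a≡n+r⇒n≡4a-r n a r eq = begin
  n              ≡⟨ solve (n ∷ r ∷ []) ring ⟩
  n ⊕ r ⊕ ⊖ r    ≡⟨ cong (_⊕ ⊖ r) eq ⟨
  4ω ⊗ a ⊕ ⊖ r   ∎

-- The unit -1 divides every 1 + e; the choice e = na keeps 1 + e nonzero, as n is not a unit.
rep-residue-1 : ∀ n a → Big n → a ≢ 0ω → 4ω ⊗ a ≡ n ⊕ ⊖ 1ω → Rep n
rep-residue-1 n a big a≢0 4a≡n+r =
  rep-of-split n a (⊖ 1ω) (n ⊗ a) 1ω (⊖ (1ω ⊕ n ⊗ a)) (big⇒nonzero n big) a≢0 4a≡n+r
    (solve (n ∷ a ∷ []) ring) (solve (n ∷ a ∷ []) ring) (big⇒1+n⊗b≢0 n a big)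

-- Here `t` represents `a` modulo `r`. As `N` is a multiple of `r`, each criterion asks that `N`
-- divide an expression in `t`, with quotient `w`; for integers `t` and `N` this is a closed
-- computation.
module _ (n a r r̄ g t N : ℤω) (big : Big n) (a≢0 : a ≢ 0ω) (4a≡n+r : 4ω ⊗ a ≡ n ⊕ r)
  (rr̄≡N : r ⊗ r̄ ≡ N) (a≡rg+t : a ≡ r ⊗ g ⊕ t) where

  private
    n≢0 : n ≢ 0ω
    n≢0 = big⇒nonzero n big

    n≡4a-r : n ≡ 4ω ⊗ a ⊕ ⊖ r
    n≡4a-r = 4a≡n+r⇒n≡4a-r n a r 4a≡n+r

    absorb : ∀ q {c w} → c ≡ N ⊗ w → r ⊗ q ⊕ c ≡ r ⊗ (q ⊕ r̄ ⊗ w)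
    absorb q {c} {w} c≡Nw = begin
      r ⊗ q ⊕ c          ≡⟨ cong (r ⊗ q ⊕_) c≡Nw ⟩
      r ⊗ q ⊕ N ⊗ w      ≡⟨ cong (λ s → r ⊗ q ⊕ s ⊗ w) rr̄≡N ⟨
      r ⊗ q ⊕ r ⊗ r̄ ⊗ w  ≡⟨ factor r r̄ q w ⟩
      r ⊗ (q ⊕ r̄ ⊗ w)    ∎
      where
      factor : ∀ r r̄ q w → r ⊗ q ⊕ r ⊗ r̄ ⊗ w ≡ r ⊗ (q ⊕ r̄ ⊗ w)
      factor = solve-∀ ring

  -- Modulo r, na ≡ 4a² ≡ 4t², so r divides na.
  rep-if-r∣t² : ∀ w → t ⊗ t ≡ N ⊗ w → Rep n
  rep-if-r∣t² w t²≡Nw = rep-of-divisor n a r _ n≢0 a≢0 4a≡n+r (begin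
    n ⊗ a
      ≡⟨ cong (_⊗ a) n≡4a-r ⟩
    (4ω ⊗ a ⊕ ⊖ r) ⊗ a
      ≡⟨ expand r a ⟩
    4ω ⊗ (a ⊗ a) ⊕ ⊖ (r ⊗ a)
      ≡⟨ cong (λ s → 4ω ⊗ (s ⊗ s) ⊕ ⊖ (r ⊗ a)) a≡rg+t ⟩
    4ω ⊗ ((r ⊗ g ⊕ t) ⊗ (r ⊗ g ⊕ t)) ⊕ ⊖ (r ⊗ a)
      ≡⟨ collect r g t a ⟩
    r ⊗ (4ω ⊗ (r ⊗ g ⊗ g ⊕ 2ω ⊗ g ⊗ t) ⊕ ⊖ a) ⊕ 4ω ⊗ (t ⊗ t)
      ≡⟨ absorb _ (trans (cong (4ω ⊗_) t²≡Nw) (swap N w)) ⟩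
    r ⊗ (4ω ⊗ (r ⊗ g ⊗ g ⊕ 2ω ⊗ g ⊗ t) ⊕ ⊖ a ⊕ r̄ ⊗ (4ω ⊗ w)) ∎)
    where
    expand : ∀ r a → (4ω ⊗ a ⊕ ⊖ r) ⊗ a ≡ 4ω ⊗ (a ⊗ a) ⊕ ⊖ (r ⊗ a)
    expand = solve-∀ ring
    collect : ∀ r g t a → 4ω ⊗ ((r ⊗ g ⊕ t) ⊗ (r ⊗ g ⊕ t)) ⊕ ⊖ (r ⊗ a)
      ≡ r ⊗ (4ω ⊗ (r ⊗ g ⊗ g ⊕ 2ω ⊗ g ⊗ t) ⊕ ⊖ a) ⊕ 4ω ⊗ (t ⊗ t)
    collect = solve-∀ ring
    swap : ∀ u w → 4ω ⊗ (u ⊗ w) ≡ u ⊗ (4ω ⊗ w)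
    swap = solve-∀ ring

  -- The split with e = au and cofactor un, where au ≡ tu modulo r. Unlike n, a may be a unit, so 1
  -- + e ≠ 0 has to be assumed.
  rep-if-r∣1+ua : ∀ u w → u ⊗ u ≡ 1ω → 1ω ⊕ t ⊗ u ≡ N ⊗ w → 1ω ⊕ a ⊗ u ≢ 0ω → Rep n
  rep-if-r∣1+ua u w u²≡1 1+tu≡Nw =
    rep-of-split n a r (a ⊗ u) (u ⊗ n) _ n≢0 a≢0 4a≡n+r (begin
      a ⊗ u ⊗ (u ⊗ n)  ≡⟨ regroup a u n ⟩
      n ⊗ a ⊗ (u ⊗ u)  ≡⟨ cong (n ⊗ a ⊗_) u²≡1 ⟩
      n ⊗ a ⊗ 1ω       ≡⟨ ⊗-identityʳ (n ⊗ a) ⟩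
      n ⊗ a            ∎) (begin
      1ω ⊕ a ⊗ u                   ≡⟨ cong (λ s → 1ω ⊕ s ⊗ u) a≡rg+t ⟩
      1ω ⊕ (r ⊗ g ⊕ t) ⊗ u         ≡⟨ collect r g t u ⟩
      r ⊗ (g ⊗ u) ⊕ (1ω ⊕ t ⊗ u)   ≡⟨ absorb (g ⊗ u) 1+tu≡Nw ⟩
      r ⊗ (g ⊗ u ⊕ r̄ ⊗ w)          ∎)
    where
    regroup : ∀ a u n → a ⊗ u ⊗ (u ⊗ n) ≡ n ⊗ a ⊗ (u ⊗ u)
    regroup = solve-∀ ring
    collect : ∀ r g t u → 1ω ⊕ (r ⊗ g ⊕ t) ⊗ u ≡ r ⊗ (g ⊗ u) ⊕ (1ω ⊕ t ⊗ u)
    collect = solve-∀ ring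

  -- The split with e = nu and cofactor ua, where n ≡ 4a ≡ 4t modulo r.
  rep-if-r∣1+un : ∀ u w → u ⊗ u ≡ 1ω → 1ω ⊕ 4ω ⊗ t ⊗ u ≡ N ⊗ w → Rep n
  rep-if-r∣1+un u w u²≡1 1+4tu≡Nw =
    rep-of-split n a r (n ⊗ u) (u ⊗ a) _ n≢0 a≢0 4a≡n+r (begin
      n ⊗ u ⊗ (u ⊗ a)  ≡⟨ regroup a u n ⟩
      n ⊗ a ⊗ (u ⊗ u)  ≡⟨ cong (n ⊗ a ⊗_) u²≡1 ⟩
      n ⊗ a ⊗ 1ω       ≡⟨ ⊗-identityʳ (n ⊗ a) ⟩
      n ⊗ a            ∎) (begin
      1ω ⊕ n ⊗ u
        ≡⟨ cong (λ s → 1ω ⊕ s ⊗ u) n≡4a-r ⟩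
      1ω ⊕ (4ω ⊗ a ⊕ ⊖ r) ⊗ u
        ≡⟨ cong (λ s → 1ω ⊕ (4ω ⊗ s ⊕ ⊖ r) ⊗ u) a≡rg+t ⟩
      1ω ⊕ (4ω ⊗ (r ⊗ g ⊕ t) ⊕ ⊖ r) ⊗ u
        ≡⟨ collect r g t u ⟩
      r ⊗ (4ω ⊗ g ⊗ u ⊕ ⊖ u) ⊕ (1ω ⊕ 4ω ⊗ t ⊗ u)
        ≡⟨ absorb (4ω ⊗ g ⊗ u ⊕ ⊖ u) 1+4tu≡Nw ⟩
      r ⊗ (4ω ⊗ g ⊗ u ⊕ ⊖ u ⊕ r̄ ⊗ w) ∎)
    (big⇒1+n⊗b≢0 n u big)
    where
    regroup : ∀ a u n → n ⊗ u ⊗ (u ⊗ a) ≡ n ⊗ a ⊗ (u ⊗ u)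
    regroup = solve-∀ ring
    collect : ∀ r g t u → 1ω ⊕ (4ω ⊗ (r ⊗ g ⊕ t) ⊕ ⊖ r) ⊗ u
      ≡ r ⊗ (4ω ⊗ g ⊗ u ⊕ ⊖ u) ⊕ (1ω ⊕ 4ω ⊗ t ⊗ u)
    collect = solve-∀ ring

  -- The split with e = -na and cofactor -1, where na ≡ 4t² modulo r.
  rep-if-r∣1-na : ∀ w → 1ω ⊕ ⊖ (4ω ⊗ t ⊗ t) ≡ N ⊗ w → Rep n
  rep-if-r∣1-na w 1-4t²≡Nw =
    rep-of-split n a r (n ⊗ ⊖ a) (⊖ 1ω) _ n≢0 a≢0 4a≡n+r (regroup n a) (begin
      1ω ⊕ n ⊗ ⊖ a
        ≡⟨ cong (λ s → 1ω ⊕ s ⊗ ⊖ a) n≡4a-r ⟩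
      1ω ⊕ (4ω ⊗ a ⊕ ⊖ r) ⊗ ⊖ a
        ≡⟨ cong (λ s → 1ω ⊕ (4ω ⊗ s ⊕ ⊖ r) ⊗ ⊖ s) a≡rg+t ⟩
      1ω ⊕ (4ω ⊗ (r ⊗ g ⊕ t) ⊕ ⊖ r) ⊗ ⊖ (r ⊗ g ⊕ t)
        ≡⟨ collect r g t ⟩
      r ⊗ (r ⊗ g ⊕ t ⊕ ⊖ (4ω ⊗ g ⊗ (r ⊗ g ⊕ 2ω ⊗ t))) ⊕ (1ω ⊕ ⊖ (4ω ⊗ t ⊗ t))
        ≡⟨ absorb _ 1-4t²≡Nw ⟩
      r ⊗ (r ⊗ g ⊕ t ⊕ ⊖ (4ω ⊗ g ⊗ (r ⊗ g ⊕ 2ω ⊗ t)) ⊕ r̄ ⊗ w) ∎)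
    (big⇒1+n⊗b≢0 n (⊖ a) big)
    where
    regroup : ∀ n a → n ⊗ ⊖ a ⊗ ⊖ 1ω ≡ n ⊗ a
    regroup = solve-∀ ring
    collect : ∀ r g t → 1ω ⊕ (4ω ⊗ (r ⊗ g ⊕ t) ⊕ ⊖ r) ⊗ ⊖ (r ⊗ g ⊕ t)
      ≡ r ⊗ (r ⊗ g ⊕ t ⊕ ⊖ (4ω ⊗ g ⊗ (r ⊗ g ⊕ 2ω ⊗ t))) ⊕ (1ω ⊕ ⊖ (4ω ⊗ t ⊗ t))
    collect = solve-∀ ring

-- If r has norm 3 and does not divide a, then n ≡ 4a ≡ a ≡ ± 1 modulo r, so r divides 1 - na.
rep-residue-3 : ∀ n a r r̄ α β → r ⊗ r̄ ≡ ι (+ 3) → √-2 ≡ r ⊗ α ⊕ ι β →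
  Big n → a ≢ 0ω → 4ω ⊗ a ≡ n ⊕ r → Rep n
rep-residue-3 n a r r̄ α β rr̄≡3 √-2≡rα+β big a≢0 4a≡n+r =
  by-residue (residue r r̄ α β 3 rr̄≡3 √-2≡rα+β a)
  where
  by-residue : (Σ (Fin 3) λ t → Σ ℤω λ g → a ≡ r ⊗ g ⊕ ι (+ toℕ t)) → Rep n
  by-residue (zero , g , eq) =
    rep-if-r∣t² n a r r̄ g 0ω (ι (+ 3)) big a≢0 4a≡n+r rr̄≡3 eq 0ω refl
  by-residue (suc zero , g , eq) =
    rep-if-r∣1-na n a r r̄ g 1ω (ι (+ 3)) big a≢0 4a≡n+r rr̄≡3 eq (ι (- + 1)) refl
  by-residue (suc (suc zero) , g , eq) =
    rep-if-r∣1-na n a r r̄ g 2ω (ι (+ 3)) big a≢0 4a≡n+r rr̄≡3 eq (ι (- + 5)) refl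

-- Modulo r the ring is ℤ/9 and n ≡ 4a.  Up to sign the units of ℤ/9 are the powers 1, 2, 4 of 2,
-- so one of a, n, na is ± 1; if a is not a unit modulo r, then r ∣ a² and so r ∣ na.
rep-residue-9 : ∀ n a r r̄ α β → r ⊗ r̄ ≡ ι (+ 9) → √-2 ≡ r ⊗ α ⊕ ι β →
  Big n → im a ≢ + 0 → 4ω ⊗ a ≡ n ⊕ r → Rep n
rep-residue-9 n a r r̄ α β rr̄≡9 √-2≡rα+β big im≢0 4a≡n+r =
  by-residue (residue r r̄ α β 9 rr̄≡9 √-2≡rα+β a)
  where
  a≢0 : a ≢ 0ω
  a≢0 = im≢0 ∘ cong im
  -- From u² = 1, the vanishing of 1 + au would give a = -u, an integer, against `im≢0`.
  1+a⊗u≢0 : ∀ u → u ⊗ u ≡ 1ω → im u ≡ + 0 → 1ω ⊕ a ⊗ u ≢ 0ω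
  1+a⊗u≢0 u u²≡1 im-u≡0 1+au≡0 = im≢0 (begin
    im a                          ≡⟨ cong im (regroup a u u²≡1) ⟩
    im ((1ω ⊕ a ⊗ u) ⊗ u ⊕ ⊖ u)   ≡⟨ cong (λ s → im (s ⊗ u ⊕ ⊖ u)) 1+au≡0 ⟩
    im (0ω ⊗ u ⊕ ⊖ u)             ≡⟨ cong im (0u-u u) ⟩
    - im u                        ≡⟨ cong -_ im-u≡0 ⟩
    + 0                           ∎)
    where
    expand : ∀ a u → (1ω ⊕ a ⊗ u) ⊗ u ⊕ ⊖ u ≡ a ⊗ (u ⊗ u)
    expand = solve-∀ ring
    0u-u : ∀ u → 0ω ⊗ u ⊕ ⊖ u ≡ ⊖ u
    0u-u = solve-∀ ring
    regroup : ∀ a u → u ⊗ u ≡ 1ω → a ≡ (1ω ⊕ a ⊗ u) ⊗ u ⊕ ⊖ u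
    regroup a u u²≡1 = sym (trans (expand a u) (trans (cong (a ⊗_) u²≡1) (⊗-identityʳ a)))
  -- The witness `w` is the quotient by 9 in each case: for instance 1 - 4·4² = -63 gives -7, and 1
  -- - 4·7 = -27 gives -3.
  by-residue : (Σ (Fin 9) λ t → Σ ℤω λ g → a ≡ r ⊗ g ⊕ ι (+ toℕ t)) → Rep n
  by-residue (zero , g , eq) =
    rep-if-r∣t² n a r r̄ g (ι (+ 0)) (ι (+ 9)) big a≢0 4a≡n+r rr̄≡9 eq 0ω refl
  by-residue (suc zero , g , eq) =
    rep-if-r∣1+ua n a r r̄ g (ι (+ 1)) (ι (+ 9)) big a≢0 4a≡n+r rr̄≡9 eq
      (⊖ 1ω) 0ω refl refl (1+a⊗u≢0 (⊖ 1ω) refl refl)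
  by-residue (suc (suc zero) , g , eq) =
    rep-if-r∣1+un n a r r̄ g (ι (+ 2)) (ι (+ 9)) big a≢0 4a≡n+r rr̄≡9 eq
      1ω 1ω refl refl
  by-residue (suc (suc (suc zero)) , g , eq) =
    rep-if-r∣t² n a r r̄ g (ι (+ 3)) (ι (+ 9)) big a≢0 4a≡n+r rr̄≡9 eq 1ω refl
  by-residue (suc (suc (suc (suc zero))) , g , eq) =
    rep-if-r∣1-na n a r r̄ g (ι (+ 4)) (ι (+ 9)) big a≢0 4a≡n+r rr̄≡9 eq (ι (- + 7)) refl
  by-residue (suc (suc (suc (suc (suc zero)))) , g , eq) =
    rep-if-r∣1-na n a r r̄ g (ι (+ 5)) (ι (+ 9)) big a≢0 4a≡n+r rr̄≡9 eq (ι (- + 11)) refl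
  by-residue (suc (suc (suc (suc (suc (suc zero))))) , g , eq) =
    rep-if-r∣t² n a r r̄ g (ι (+ 6)) (ι (+ 9)) big a≢0 4a≡n+r rr̄≡9 eq 4ω refl
  by-residue (suc (suc (suc (suc (suc (suc (suc zero)))))) , g , eq) =
    rep-if-r∣1+un n a r r̄ g (ι (+ 7)) (ι (+ 9)) big a≢0 4a≡n+r rr̄≡9 eq (⊖ 1ω) (ι (- + 3)) refl refl
  by-residue (suc (suc (suc (suc (suc (suc (suc (suc zero))))))) , g , eq) =
    rep-if-r∣1+ua n a r r̄ g (ι (+ 8)) (ι (+ 9)) big a≢0 4a≡n+r rr̄≡9 eq 1ω 1ω refl refl (1+a⊗u≢0 1ω refl refl)

-- Elements with odd real part.

-- Gives `a` and `r` from remainders s, t of the coordinates of n modulo 4. Negative remainders are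
-- allowed, which keeps r small.
four-times : ∀ i j s t →
  4ω ⊗ (i + j ω) ≡ ((s + i * + 4) + (t + j * + 4) ω) ⊕ ((- s) + (- t) ω)
four-times i j s t = cong₂ _+_ω (re-eq i j s) (im-eq i j t)
  where
  re-eq : ∀ i j s → + 4 * i - + 2 * (+ 0 * j) ≡ s + i * + 4 + - s
  re-eq = ℤ-solve-∀
  im-eq : ∀ i j t → + 4 * j + + 0 * i ≡ t + j * + 4 + - t
  im-eq = ℤ-solve-∀

-- If a = 0, then n = -r, whose norm is too small.
quarter≢0 : ∀ n a r → 4ω ⊗ a ≡ n ⊕ r → Big n → ‖ ⊖ r ‖ ℕ.≤ 3 → a ≢ 0ω
quarter≢0 n a r 4a≡n+r big small refl =
  contradiction (subst Big (⊕≡0⇒≡⊖ n r (sym 4a≡n+r)) big) (ℕ.≤⇒≯ small)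

-- The remainder r has real part -1, and y modulo 4 selects its other coordinate among 0, ± 1 and ±
-- 2, so that its norm is 1, 3 or 9.
rep-1-mod-4 : ∀ i y → Big ((+ 1 + i * + 4) + y ω) → Rep ((+ 1 + i * + 4) + y ω)
rep-1-mod-4 i y big = by-residue y big (divMod 4 y)
  where
  n : ℤ → ℤω
  n y = (+ 1 + i * + 4) + y ω

  shift : ∀ j → - + 1 + (+ 1 + j) * + 4 ≡ + 3 + j * + 4
  shift = ℤ-solve-∀

  -- r = -1 ± 2√-2, with the sign chosen so that a is not an integer: for a = ± 1, 1 + e could vanish.
  rep-2-mod-4 : ∀ j → Dec (j ≡ + 0) → Big (n (+ 2 + j * + 4)) → Rep (n (+ 2 + j * + 4))
  rep-2-mod-4 j (no j≢0) big = rep-residue-9 (n (+ 2 + j * + 4)) (i + j ω)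
    -- Modulo this r, √-2 ≡ 4, since (-1 - 2√-2)(-√-2) = √-2 - 4.
    ((- + 1) + - + 2 ω) ((- + 1) + + 2 ω) (⊖ √-2) (+ 4) refl refl big j≢0
    (four-times i j (+ 1) (+ 2))
  rep-2-mod-4 j (yes refl) big = rep-residue-9 (n (+ 2)) (i + + 1 ω)
    ((- + 1) + + 2 ω) ((- + 1) + - + 2 ω) (⊖ √-2) (- + 4) refl refl big (λ ())
    (four-times i (+ 1) (+ 1) (- + 2))

  by-residue : ∀ y → Big (n y) → (Σ (Fin 4) λ t → Σ ℤ λ j → y ≡ + toℕ t + j * + 4) → Rep (n y)
  by-residue y big (zero , j , refl) =
    rep-residue-1 (n y) (i + j ω) big (quarter≢0 (n y) (i + j ω) (⊖ 1ω) 4a≡n+r big (ℕ.s≤s ℕ.z≤n)) 4a≡n+r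
    where
    4a≡n+r : 4ω ⊗ (i + j ω) ≡ n y ⊕ ⊖ 1ω
    4a≡n+r = four-times i j (+ 1) (+ 0)
  by-residue y big (suc zero , j , refl) =
    rep-residue-3 (n y) (i + j ω) r ((- + 1) + + 1 ω) (⊖ 1ω) (- + 1) refl refl big
      (quarter≢0 (n y) (i + j ω) r 4a≡n+r big ℕ.≤-refl) 4a≡n+r
    where
    r : ℤω
    r = (- + 1) + - + 1 ω
    4a≡n+r : 4ω ⊗ (i + j ω) ≡ n y ⊕ r
    4a≡n+r = four-times i j (+ 1) (+ 1)
  by-residue y big (suc (suc zero) , j , refl) = rep-2-mod-4 j (j ≟ + 0) big
  -- The remainder 3 is read as -1, raising j by one, so that r has norm 3.
  by-residue y big (suc (suc (suc zero)) , j , refl) =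
    rep-residue-3 (n y) (i + (+ 1 + j) ω) r ((- + 1) + - + 1 ω) 1ω (+ 1) refl refl big
      (quarter≢0 (n y) (i + (+ 1 + j) ω) r 4a≡n+r big ℕ.≤-refl) 4a≡n+r
    where
    r : ℤω
    r = (- + 1) + + 1 ω
    4a≡n+r : 4ω ⊗ (i + (+ 1 + j) ω) ≡ n y ⊕ r
    4a≡n+r = trans (four-times i (+ 1 + j) (+ 1) (- + 1))
      (cong (λ y → n y ⊕ r) (shift j))

-- Up to sign an odd integer is 1 modulo 4: -(3 + 4j) = 1 - 4(1 + j).
rep-odd : ∀ i y → Big ((+ 1 + i * + 2) + y ω) → Rep ((+ 1 + i * + 2) + y ω)
rep-odd i y = by-residue i (divMod 2 i)
  where
  n : ℤ → ℤω
  n i = (+ 1 + i * + 2) + y ω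

  by-residue : ∀ i → (Σ (Fin 2) λ t → Σ ℤ λ j → i ≡ + toℕ t + j * + 2) → Big (n i) → Rep (n i)
  by-residue i (zero , j , refl) big = subst Rep (sym n≡m) (rep-1-mod-4 j y (subst Big n≡m big))
    where
    re-eq : ∀ j → + 1 + (+ 0 + j * + 2) * + 2 ≡ + 1 + j * + 4
    re-eq = ℤ-solve-∀
    n≡m : n i ≡ ((+ 1 + j * + 4) + y ω)
    n≡m = cong (_+ y ω) (re-eq j)
  by-residue i (suc zero , j , refl) big = subst Rep (sym n≡-m)
    (rep-scale m (⊖ 1ω) (λ ()) (rep-1-mod-4 (- (+ 1 + j)) (- y) big-m))
    where
    m : ℤω
    m = (+ 1 + (- (+ 1 + j)) * + 4) + - y ω
    re-eq : ∀ j y →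
      + 1 + (+ 1 + j * + 2) * + 2 ≡ - + 1 * (+ 1 + (- (+ 1 + j)) * + 4) - + 2 * (+ 0 * - y)
    re-eq = ℤ-solve-∀
    im-eq : ∀ j y → y ≡ - + 1 * (- y) + + 0 * (+ 1 + (- (+ 1 + j)) * + 4)
    im-eq = ℤ-solve-∀
    n≡-m : n i ≡ ⊖ 1ω ⊗ m
    n≡-m = cong₂ _+_ω (re-eq j y) (im-eq j y)
    big-m : Big m
    big-m = subst (3 ℕ.<_)
      (trans (cong ‖_‖ n≡-m) (trans (‖‖-⊗ (⊖ 1ω) m) (ℕ.*-identityˡ ‖ m ‖))) big

-- Elements with even real part.

square≤3⇒≤1 : ∀ m → m ℕ.* m ℕ.≤ 3 → m ℕ.≤ 1
square≤3⇒≤1 m m²≤3 = ℕ.≮⇒≥ λ 2≤m → ℕ.<⇒≱ (ℕ.*-mono-≤ 2≤m 2≤m) m²≤3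

rep-2 : Rep 2ω
rep-2 = 1ω , 2ω , 2ω , (λ ()) , (λ ()) , (λ ()) , refl

-- This holds because 3/(2 + √-2) = 1 + 1/√-2.
rep-2+√-2 : Rep (2ω ⊕ √-2)
rep-2+√-2 = 1ω , √-2 , 2ω ⊕ √-2 , (λ ()) , (λ ()) , (λ ()) , refl

rep-2-√-2 : Rep (2ω ⊕ ⊖ √-2)
rep-2-√-2 = 1ω , ⊖ √-2 , 2ω ⊕ ⊖ √-2 , (λ ()) , (λ ()) , (λ ()) , refl

-- The product is -2y + x√-2: either 0 or ± √-2, of norm at most 2, or one of 2, 2 ± √-2 up to sign.
rep-√-2⊗small : ∀ x y → ∣ x ∣ ℕ.≤ 1 → ∣ y ∣ ℕ.≤ 1 → Big (√-2 ⊗ (x + y ω)) → Rep (√-2 ⊗ (x + y ω))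
rep-√-2⊗small (+ 0) (+ 0) _ _ ()
rep-√-2⊗small (+ 0) (+ 1) _ _ _ = rep-scale 2ω (⊖ 1ω) (λ ()) rep-2
rep-√-2⊗small (+ 0) -[1+ 0 ] _ _ _ = rep-2
rep-√-2⊗small (+ 1) (+ 0) _ _ (ℕ.s≤s (ℕ.s≤s ()))
rep-√-2⊗small (+ 1) (+ 1) _ _ _ = rep-scale (2ω ⊕ ⊖ √-2) (⊖ 1ω) (λ ()) rep-2-√-2
rep-√-2⊗small (+ 1) -[1+ 0 ] _ _ _ = rep-2+√-2
rep-√-2⊗small -[1+ 0 ] (+ 0) _ _ (ℕ.s≤s (ℕ.s≤s ()))
rep-√-2⊗small -[1+ 0 ] (+ 1) _ _ _ = rep-scale (2ω ⊕ √-2) (⊖ 1ω) (λ ()) rep-2+√-2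
rep-√-2⊗small -[1+ 0 ] -[1+ 0 ] _ _ _ = rep-2-√-2
rep-√-2⊗small (+ ℕ.suc (ℕ.suc _)) _ (ℕ.s≤s ()) _ _
rep-√-2⊗small -[1+ ℕ.suc _ ] _ (ℕ.s≤s ()) _ _
rep-√-2⊗small _ (+ ℕ.suc (ℕ.suc _)) _ (ℕ.s≤s ()) _
rep-√-2⊗small _ -[1+ ℕ.suc _ ] _ (ℕ.s≤s ()) _

-- A representation of the cofactor m scales by √-2 if m is big; otherwise both coordinates of m are
-- at most 1 in absolute value.
rep-√-2⊗odd : ∀ j z → let m = (+ 1 + j * + 2) + z ω in Big (√-2 ⊗ m) → Rep (√-2 ⊗ m)
rep-√-2⊗odd j z big = by-size (3 ℕ.<? ‖ m ‖)
  where
  x : ℤ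
  x = + 1 + j * + 2
  m : ℤω
  m = x + z ω
  by-size : Dec (Big m) → Rep (√-2 ⊗ m)
  by-size (yes big-m) = rep-scale m √-2 (λ ()) (rep-odd j z big-m)
  by-size (no ¬big-m) = rep-√-2⊗small x z
    (square≤3⇒≤1 ∣ x ∣ (ℕ.≤-trans (ℕ.m≤m+n _ _) ‖m‖≤3))
    (square≤3⇒≤1 ∣ z ∣ (ℕ.≤-trans (ℕ.m≤m+n _ _) (ℕ.≤-trans (ℕ.m≤n+m _ (∣ x ∣ ℕ.* ∣ x ∣)) ‖m‖≤3)))
    big
    where
    ‖m‖≤3 : ‖ m ‖ ℕ.≤ 3
    ‖m‖≤3 = ℕ.≮⇒≥ ¬big-m

-- If y is even, n is a multiple of 2; if y is odd, n = √-2 (y - k√-2), whose cofactor has odd real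
-- part.
rep-even : ∀ k y → Big ((+ 0 + k * + 2) + y ω) → Rep ((+ 0 + k * + 2) + y ω)
rep-even k y = by-residue y (divMod 2 y)
  where
  n : ℤ → ℤω
  n y = (+ 0 + k * + 2) + y ω

  by-residue : ∀ y → (Σ (Fin 2) λ t → Σ ℤ λ j → y ≡ + toℕ t + j * + 2) → Big (n y) → Rep (n y)
  by-residue y (zero , j , refl) big = subst Rep (sym n≡m⊗2) (rep-scale 2ω m m≢0 rep-2)
    where
    m : ℤω
    m = k + j ω
    re-eq : ∀ k j → + 0 + k * + 2 ≡ k * + 2 - + 2 * (j * + 0)
    re-eq = ℤ-solve-∀
    im-eq : ∀ k j → + 0 + j * + 2 ≡ k * + 0 + j * + 2
    im-eq = ℤ-solve-∀
    n≡m⊗2 : n y ≡ m ⊗ 2ω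
    n≡m⊗2 = cong₂ _+_ω (re-eq k j) (im-eq k j)
    m≢0 : m ≢ 0ω
    m≢0 m≡0 = big⇒nonzero (n y) big (trans n≡m⊗2 (trans (cong (_⊗ 2ω) m≡0) (⊗-zeroˡ 2ω)))
  by-residue y (suc zero , j , refl) big =
    subst Rep (sym n≡√-2⊗m) (rep-√-2⊗odd j (- k) (subst Big n≡√-2⊗m big))
    where
    re-eq : ∀ k j → + 0 + k * + 2 ≡ + 0 * (+ 1 + j * + 2) - + 2 * (+ 1 * - k)
    re-eq = ℤ-solve-∀
    im-eq : ∀ k j → + 1 + j * + 2 ≡ + 0 * - k + + 1 * (+ 1 + j * + 2)
    im-eq = ℤ-solve-∀
    n≡√-2⊗m : n y ≡ √-2 ⊗ ((+ 1 + j * + 2) + - k ω)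
    n≡√-2⊗m = cong₂ _+_ω (re-eq k j) (im-eq k j)

theorem11 : (n : ℤω) → normω n > + 3 →
    Σ ℤω λ a → Σ ℤω λ b → Σ ℤω λ c →
    a ≢ 0ω × b ≢ 0ω × c ≢ 0ω × EgyptianRep n a b c
theorem11 (x + y ω) norm>3 =
  by-residue (divMod 2 x) (ℤ.drop‿+<+ (subst (_> + 3) (normω-‖‖ (x + y ω)) norm>3))
  where
  -- The real part is even exactly when √-2 divides the element. Generalising over `x` lets `refl`
  -- substitute for it.
  by-residue : ∀ {x} → (Σ (Fin 2) λ t → Σ ℤ λ i → x ≡ + toℕ t + i * + 2) → Big (x + y ω) → Rep (x + y ω)
  by-residue (zero , i , refl) = rep-even i y
  by-residue (suc zero , i , refl) = rep-odd i y
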